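{- Let $T$ be a finite tree. Then $T$ is $\mathbb{Z}_2^2$-cordial if and only if $T$ is not isomorphic to $P_4$ or $P_5$. Equivalently: every finite tree other than $P_4$ and $P_5$ is $\mathbb{Z}_2^2$-cordial (and $P_4$, $P_5$ are not).
   Context: Graphs are finite, simple and undirected. $\mathbb{Z}_2^2=\mathbb{Z}_2\times\mathbb{Z}_2$ is the Klein four-group. For an abelian group $A$ and a graph $G=(V,E)$, a vertex labeling $\ell:V\to A$ induces an edge labeling $\ell(\{v_1,v_2\})=\ell(v_1)+\ell(v_2)$. Let $f_V(a)=|\{v\in V:\ell(v)=a\}|$ and $f_E(a)=|\{e\in E:\ell(e)=a\}|$. The labeling is $A$-cordial if $|f_V(a_1)-f_V(a_2)|\le 1$ and $|f_E(a_1)-f_E(a_2)|\le 1$ for all $a_1,a_2\in A$; $G$ is $A$-cordial if it admits an $A$-cordial labeling. $P_n$ denotes the path on $n$ vertices. -}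

module Defs where

open import Algebra.Bundles using (AbelianGroup)
import Algebra.Construct.DirectProduct as DirectProduct
open import Data.Fin using (Fin; zero; suc; toℕ; fromℕ; inject₁; _<?_)
open import Data.List using (List; length; filter; allFin; cartesianProduct)
open import Data.Nat as ℕ using (ℕ; NonZero; _≤_; ∣_-_∣)
open import Data.Nat.Properties using (1+n≢n)
open import Data.Parity.Properties as ℙ using (+-0-abelianGroup)
open import Data.Product using (Σ-syntax; ∃-syntax; _×_; _,_)
open import Data.Product.Relation.Binary.Pointwise.NonDependent using (×-decidable)
open import Data.Sum using (_⊎_; inj₁; inj₂; swap)
open import Function using (Injective; Inverse; _↔_; _⇔_)
open import Level using (Level; 0ℓ)
open import Relation.Binary using (Rel; Decidable; Symmetric; Irreflexive)
open import Relation.Binary.Construct.Closure.ReflexiveTransitive using (Star)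
open import Relation.Binary.PropositionalEquality using (_≡_; refl; sym)
open import Relation.Nullary using (¬_)
open import Relation.Nullary.Decidable using (_×-dec_; _⊎-dec_)

private
  variable
    c r : Level
    m n : ℕ

record Graph (n : ℕ) : Set₁ where
  field
    Adj        : Rel (Fin n) 0ℓ
    adj?       : Decidable Adj
    adj-sym    : Symmetric Adj
    adj-irrefl : Irreflexive _≡_ Adj

  vertices : List (Fin n)
  vertices = allFin n

  -- The edge {u , v} is listed once, as the pair (u , v) with u < v.
  edges : List (Fin n × Fin n)
  edges = filter (λ (u , v) → (u <? v) ×-dec adj? u v)
                 (cartesianProduct vertices vertices)

infix 4 _≅_

_≅_ : Graph m → Graph n → Set
_≅_ {m} {n} G H =
  Σ[ φ ∈ Fin m ↔ Fin n ]
    (∀ u v → Graph.Adj G u v ⇔ Graph.Adj H (Inverse.to φ u) (Inverse.to φ v))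

Connected : Graph n → Set
Connected G = ∀ u v → Star (Graph.Adj G) u v

-- A cycle is a sequence of 3 + k distinct vertices, consecutive ones adjacent
-- and the last adjacent to the first.
IsCycle : (G : Graph n) (k : ℕ) → (Fin (3 ℕ.+ k) → Fin n) → Set
IsCycle G k w =
    Injective _≡_ _≡_ w
  × (∀ (i : Fin (2 ℕ.+ k)) → Graph.Adj G (w (inject₁ i)) (w (suc i)))
  × Graph.Adj G (w (fromℕ (2 ℕ.+ k))) (w zero)

Acyclic : Graph n → Set
Acyclic G = ¬ (∃[ k ] ∃[ w ] IsCycle G k w)

record IsTree {n : ℕ} (G : Graph n) : Set where
  field
    nonEmpty  : NonZero n
    connected : Connected G
    acyclic   : Acyclic G

P : (n : ℕ) → Graph n
P n = record
  { Adj        = λ i j → (toℕ j ≡ ℕ.suc (toℕ i)) ⊎ (toℕ i ≡ ℕ.suc (toℕ j))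
  ; adj?       = λ i j → (toℕ j ℕ.≟ ℕ.suc (toℕ i)) ⊎-dec (toℕ i ℕ.≟ ℕ.suc (toℕ j))
  ; adj-sym    = swap
  ; adj-irrefl = λ { refl (inj₁ e) → 1+n≢n (sym e)
                   ; refl (inj₂ e) → 1+n≢n (sym e) }
  }

-- The group is taken with decidable equality so that label classes can be counted.
module Cordiality (A : AbelianGroup c r)
                  (_≟_ : Decidable (AbelianGroup._≈_ A)) where

  open AbelianGroup A using (Carrier; _∙_)

  module _ {n : ℕ} (G : Graph n) (ℓ : Fin n → Carrier) where

    open Graph G using (vertices; edges)

    edgeLabel : Fin n × Fin n → Carrier
    edgeLabel (u , v) = ℓ u ∙ ℓ v

    f-V : Carrier → ℕ
    f-V a = length (filter (λ v → ℓ v ≟ a) vertices)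

    f-E : Carrier → ℕ
    f-E a = length (filter (λ e → edgeLabel e ≟ a) edges)

    IsCordialLabeling : Set c
    IsCordialLabeling =
        (∀ a₁ a₂ → ∣ f-V a₁ - f-V a₂ ∣ ≤ 1)
      × (∀ a₁ a₂ → ∣ f-E a₁ - f-E a₂ ∣ ≤ 1)

  Cordial : Graph n → Set c
  Cordial G = ∃[ ℓ ] IsCordialLabeling G ℓ

-- ℤ₂ is the additive group of parities.
ℤ₂² : AbelianGroup 0ℓ 0ℓ
ℤ₂² = DirectProduct.abelianGroup +-0-abelianGroup +-0-abelianGroup

_≟ℤ₂²_ : Decidable (AbelianGroup._≈_ ℤ₂²)
_≟ℤ₂²_ = ×-decidable ℙ._≟_ ℙ._≟_

open Cordiality ℤ₂² _≟ℤ₂²_ public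
  using () renaming (Cordial to ℤ₂²-Cordial)

{-# OPTIONS --safe #-}
module Submission where

-- Deleting leaves one at a time, a balanced labelling extends from 4k to 4k + 1, 4k + 2 and 4k + 3 vertices
-- for trivial reasons. A tree on 4k + 4 vertices that is not a path has three leaves, and by Hall's theorem on
-- permutations of ℤ₂² a balanced labelling of the tree without them always extends to the three leaves: their
-- labels are forced as a set, and they can be distributed so that the three new edges get distinct labels.
-- Paths on 4k vertices, k ≥ 2, are labelled explicitly with period 8. On 5, 6 and 8 vertices a deletion may lead
-- to P₄ or P₅; there one extends labellings of P₂, P₃ and P₅ to three further leaves, by finite search.

open import Algebra.Bundles using (AbelianGroup)
import Algebra.Properties.CommutativeMonoid.Sum as CMSum
open import Data.Bool using (true; false; if_then_else_)
open import Data.Fin using (Fin; zero; suc; toℕ; fromℕ; inject₁; inject≤; punchIn; punchOut; opposite; _<?_; _≟_)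
open import Data.Fin.Patterns using (0F; 1F; 2F; 3F; 4F)
open import Data.Fin.Permutation using (insert; ↔⇒≡; _⟨$⟩ʳ_; _⟨$⟩ˡ_; inverseˡ; inverseʳ; _∘ₚ_; flip)
import Data.Fin.Permutation as Perm
open import Data.Fin.Properties
  using (punchIn-punchOut; punchInᵢ≢i; punchIn-injective; toℕ-injective; any?; all?; <-cmp; injective⇒≤
        ; toℕ-inject₁; opposite-involutive; opposite-prop; toℕ<n; toℕ-inject≤
        ; toℕ-fromℕ; inject≤-injective)
open import Data.List using ([]; _∷_; length; filter; map; allFin; cartesianProduct; tabulate; _++_)
import Data.List.Properties as List
open import Data.Nat using (ℕ; zero; suc; _+_; _*_; _∸_; _≤_; z≤n; s≤s; s≤s⁻¹; ∣_-_∣; NonZero)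
open import Data.Nat.Properties
  using (+-comm; +-assoc; +-identityʳ; +-suc; +-0-commutativeMonoid; suc-injective
        ; ≤-refl; ≤-trans; ≤-reflexive; 1+n≰n; _≤?_)
import Data.Nat.Properties as ℕ
open import Data.Nat.Solver using (module +-*-Solver)
open import Data.Parity using (0ℙ; 1ℙ)
import Data.Parity as ℙ
open import Data.Product using (Σ-syntax; ∃; ∃-syntax; _×_; _,_; proj₁; proj₂)
open import Data.Sum using (_⊎_; inj₁; inj₂; [_,_]′)
import Data.Sum as Sum
open import Data.Vec.Functional using (Vector; insertAt) renaming ([] to []ᵛ; _∷_ to _∷ᵛ_)
open import Data.Vec.Functional.Properties using (insertAt-lookup; insertAt-punchIn)
open import Function using (_∘_; _⇔_; Equivalence; mk⇔; Inverse; Injective; id)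
open import Relation.Binary using (tri<; tri≈; tri>)
open import Relation.Binary.Construct.Closure.ReflexiveTransitive using (Star; ε; _◅_)
open import Relation.Binary.PropositionalEquality
  using (_≡_; _≢_; _≗_; refl; sym; trans; cong; cong₂; subst; module ≡-Reasoning)
open import Relation.Nullary using (¬_; Dec; yes; no; does; contradiction)
open import Relation.Nullary.Decidable using (_×-dec_; _⊎-dec_; _→-dec_; ¬?; from-yes; map′; does-⇔; decidable-stable)
open import Defs

open CMSum +-0-commutativeMonoid using (sum; sum-cong-≗; sum-remove; ∑-distrib-+; ∑-comm; ∑-permute; sum-replicate-zero)
open AbelianGroup ℤ₂² using () renaming (Carrier to A)
open Cordiality ℤ₂² _≟ℤ₂²_ using (f-V; f-E)

private
  variable
    m n : ℕ

-- Indicators, Kronecker deltas and finite sums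

-- Definitionally the group operation of ℤ₂², but with normal forms that do not contain the bundle.
_⊕_ : A → A → A
u ⊕ v = proj₁ u ℙ.+ proj₁ v , proj₂ u ℙ.+ proj₂ v

indicator : ∀ {P : Set} → Dec P → ℕ
indicator d = if does d then 1 else 0

indicator-⇔ : ∀ {P Q : Set} → P ⇔ Q → (p? : Dec P) (q? : Dec Q) → indicator p? ≡ indicator q?
indicator-⇔ P⇔Q p? q? = cong (if_then 1 else 0) (does-⇔ P⇔Q p? q?)

indicator-yes : ∀ {P : Set} (p? : Dec P) → P → indicator p? ≡ 1
indicator-yes (yes _) _ = refl
indicator-yes (no ¬p) p = contradiction p ¬p

indicator-no : ∀ {P : Set} (p? : Dec P) → ¬ P → indicator p? ≡ 0
indicator-no (yes p) ¬p = contradiction p ¬p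
indicator-no (no _)  _  = refl

indicator-× : ∀ {P Q : Set} (p? : Dec P) (q? : Dec Q) → indicator (p? ×-dec q?) ≡ indicator p? * indicator q?
indicator-× p? q? with does p? | does q?
... | true  | true  = refl
... | true  | false = refl
... | false | _     = refl

-- Kept opaque so that type checking compares sums of δ's without evaluating them.
opaque
  δ : A → A → ℕ
  δ x a = indicator (x ≟ℤ₂² a)

  δ-indicator : ∀ x a → δ x a ≡ indicator (x ≟ℤ₂² a)
  δ-indicator x a = refl

⊕-comm : ∀ x y → x ⊕ y ≡ y ⊕ x
⊕-comm x y with p , q ← AbelianGroup.comm ℤ₂² x y = cong₂ _,_ p q

sum-zero : (t : Vector ℕ n) → (∀ i → t i ≡ 0) → sum t ≡ 0
sum-zero {n} t t≡0 = trans (sum-cong-≗ t≡0) (sum-replicate-zero n)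

sum-single : (t : Vector ℕ n) (i : Fin n) → (∀ j → j ≢ i → t j ≡ 0) → sum t ≡ t i
sum-single {suc n} t i t≡0 = trans (sum-remove {i = i} t)
  (trans (cong (t i +_) (sum-zero _ λ j → t≡0 (punchIn i j) (punchInᵢ≢i i j))) (+-identityʳ (t i)))

-- Vertex and edge counts as sums

vertexCount : (Fin n → A) → A → ℕ
vertexCount ℓ a = sum (λ v → δ (ℓ v) a)

arcWeight : Graph n → (Fin n → A) → A → Fin n → Fin n → ℕ
arcWeight G ℓ a u w = indicator (Graph.adj? G u w) * δ (ℓ u ⊕ ℓ w) a

-- Ordered pairs count each edge twice, but the sum is then invariant under every renumbering of the
-- vertices, which the restriction to `u < w` is not.
arcCount : Graph n → (Fin n → A) → A → ℕ
arcCount G ℓ a = sum (λ u → sum (λ w → arcWeight G ℓ a u w))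

arcWeight-sym : (G : Graph n) (ℓ : Fin n → A) (a : A) → ∀ u w → arcWeight G ℓ a u w ≡ arcWeight G ℓ a w u
arcWeight-sym G ℓ a u w = cong₂ _*_
  (indicator-⇔ (mk⇔ (Graph.adj-sym G) (Graph.adj-sym G)) (Graph.adj? G u w) (Graph.adj? G w u))
  (cong (λ x → δ x a) (⊕-comm (ℓ u) (ℓ w)))

arcWeight-irrefl : (G : Graph n) (ℓ : Fin n → A) (a : A) → ∀ u → arcWeight G ℓ a u u ≡ 0
arcWeight-irrefl G ℓ a u = cong (_* δ (ℓ u ⊕ ℓ u) a) (indicator-no (Graph.adj? G u u) (Graph.adj-irrefl G refl))

length-filter-tabulate : ∀ {B : Set} {Q : B → Set} (Q? : ∀ b → Dec (Q b)) (f : Fin n → B) →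
  length (filter Q? (tabulate f)) ≡ sum (indicator ∘ Q? ∘ f)
length-filter-tabulate {zero}  Q? f = refl
length-filter-tabulate {suc n} Q? f with does (Q? (f zero))
... | true  = cong suc (length-filter-tabulate Q? (f ∘ suc))
... | false = length-filter-tabulate Q? (f ∘ suc)

filter-filter-length : ∀ {B : Set} {Q R : B → Set} (Q? : ∀ b → Dec (Q b)) (R? : ∀ b → Dec (R b)) xs →
  length (filter R? (filter Q? xs)) ≡ length (filter (λ b → Q? b ×-dec R? b) xs)
filter-filter-length Q? R? [] = refl
filter-filter-length Q? R? (x ∷ xs) with does (Q? x)
... | false = filter-filter-length Q? R? xs
... | true with does (R? x)
...   | true  = cong suc (filter-filter-length Q? R? xs)
...   | false = filter-filter-length Q? R? xs

length-filter-cartesianProduct : ∀ {Q : Fin m × Fin n → Set} (Q? : ∀ b → Dec (Q b)) {k} (f : Fin k → Fin m) →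
  length (filter Q? (cartesianProduct (tabulate f) (allFin n))) ≡ sum (λ i → sum (λ j → indicator (Q? (f i , j))))
length-filter-cartesianProduct Q? {zero} f = refl
length-filter-cartesianProduct {n = n} Q? {suc k} f = begin
  length (filter Q? (map (f zero ,_) (allFin n) ++ rest))
    ≡⟨ cong length (List.filter-++ Q? (map (f zero ,_) (allFin n)) rest) ⟩
  length (filter Q? (map (f zero ,_) (allFin n)) ++ filter Q? rest)
    ≡⟨ List.length-++ (filter Q? (map (f zero ,_) (allFin n))) ⟩
  length (filter Q? (map (f zero ,_) (allFin n))) + length (filter Q? rest)
    ≡⟨ cong₂ _+_ (trans (cong (length ∘ filter Q?) (List.map-tabulate id (f zero ,_)))
                        (length-filter-tabulate Q? (f zero ,_)))
                 (length-filter-cartesianProduct Q? (f ∘ suc)) ⟩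
  sum (λ i → sum (λ j → indicator (Q? (f i , j)))) ∎
  where
  open ≡-Reasoning
  rest = cartesianProduct (tabulate (f ∘ suc)) (allFin n)

f-V≡vertexCount : (G : Graph n) (ℓ : Fin n → A) (a : A) → f-V G ℓ a ≡ vertexCount ℓ a
f-V≡vertexCount G ℓ a = trans (length-filter-tabulate (λ v → ℓ v ≟ℤ₂² a) id)
  (sum-cong-≗ λ v → sym (δ-indicator (ℓ v) a))

f-E≡sum : (G : Graph n) (ℓ : Fin n → A) (a : A) →
  f-E G ℓ a ≡ sum (λ u → sum (λ w → indicator (u <? w) * arcWeight G ℓ a u w))
f-E≡sum G ℓ a = trans (filter-filter-length before? label? (cartesianProduct (allFin _) (allFin _)))
  (trans (length-filter-cartesianProduct (λ e → before? e ×-dec label? e) id)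
    (sum-cong-≗ λ u → sum-cong-≗ λ w → split u w))
  where
  before? = λ (u , w) → (u <? w) ×-dec Graph.adj? G u w
  label?  = λ (u , w) → (ℓ u ⊕ ℓ w) ≟ℤ₂² a
  split : ∀ u w → indicator (before? (u , w) ×-dec label? (u , w)) ≡ indicator (u <? w) * arcWeight G ℓ a u w
  split u w = trans (indicator-× (before? (u , w)) (label? (u , w)))
    (trans (cong₂ _*_ (indicator-× (u <? w) (Graph.adj? G u w)) (sym (δ-indicator (ℓ u ⊕ ℓ w) a)))
           (ℕ.*-assoc (indicator (u <? w)) _ _))

-- Exchanging the two sums turns the second copy into the count over `w < u`. By trichotomy the
-- copies together cover all ordered pairs; the diagonal contributes nothing by irreflexivity.
f-E-double : (G : Graph n) (ℓ : Fin n → A) (a : A) → f-E G ℓ a + f-E G ℓ a ≡ arcCount G ℓ a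
f-E-double G ℓ a = begin
  f-E G ℓ a + f-E G ℓ a
    ≡⟨ cong₂ _+_ (f-E≡sum G ℓ a) (trans (f-E≡sum G ℓ a) (∑-comm up)) ⟩
  sum (λ u → sum (up u)) + sum (λ u → sum (λ w → up w u))
    ≡⟨ ∑-distrib-+ (λ u → sum (up u)) _ ⟨
  sum (λ u → sum (up u) + sum (λ w → up w u))
    ≡⟨ sum-cong-≗ (λ u → trans (sym (∑-distrib-+ (up u) _)) (sum-cong-≗ (both u))) ⟩
  arcCount G ℓ a ∎
  where
  open ≡-Reasoning
  g = arcWeight G ℓ a
  up = λ u w → indicator (u <? w) * g u w
  both : ∀ u w → up u w + up w u ≡ g u w
  both u w with <-cmp u w
  ... | tri< u<w _ w≮u rewrite indicator-yes (u <? w) u<w | indicator-no (w <? u) w≮u =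
        trans (+-identityʳ _) (+-identityʳ _)
  ... | tri> u≮w _ w<u rewrite indicator-yes (w <? u) w<u | indicator-no (u <? w) u≮w =
        trans (+-identityʳ _) (arcWeight-sym G ℓ a w u)
  ... | tri≈ u≮u refl _ rewrite indicator-no (u <? u) u≮u = sym (arcWeight-irrefl G ℓ a u)

-- Prescribed counts and isomorphisms

record Counts (G : Graph n) (ℓ : Fin n → A) (V E : A → ℕ) : Set where
  constructor counts
  field
    vertexCount≡ : ∀ a → vertexCount ℓ a ≡ V a
    arcCount≡    : ∀ a → arcCount G ℓ a ≡ E a + E a

≅-counts : (G : Graph m) (H : Graph n) ((φ , _) : G ≅ H) {ℓ : Fin n → A} {V E : A → ℕ} →
  Counts H ℓ V E → Counts G (ℓ ∘ Inverse.to φ) V E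
≅-counts G H (φ , φ-adj) {ℓ} (counts c d) = counts
  (λ a → trans (sym (∑-permute (λ v → δ (ℓ v) a) φ)) (c a))
  λ a → trans (sum-cong-≗ λ u → trans (sum-cong-≗ λ w → cong (_* δ (ℓ (φ ⟨$⟩ʳ u) ⊕ ℓ (φ ⟨$⟩ʳ w)) a)
            (indicator-⇔ (φ-adj u w) (Graph.adj? G u w) (Graph.adj? H (φ ⟨$⟩ʳ u) (φ ⟨$⟩ʳ w))))
                                  (sym (∑-permute (arcWeight H ℓ a (φ ⟨$⟩ʳ u)) φ)))
      (trans (sym (∑-permute (λ u → sum (arcWeight H ℓ a u)) φ)) (d a))

-- Deleting and attaching a leaf

delete : Graph (suc n) → Fin (suc n) → Graph n
delete G v = record
  { Adj        = λ i j → Graph.Adj G (punchIn v i) (punchIn v j)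
  ; adj?       = λ i j → Graph.adj? G (punchIn v i) (punchIn v j)
  ; adj-sym    = Graph.adj-sym G
  ; adj-irrefl = λ { refl → Graph.adj-irrefl G refl }
  }

LeafAt : Graph n → Fin n → Fin n → Set
LeafAt G v p = Graph.Adj G v p × (∀ {w} → Graph.Adj G v w → w ≡ p)

Leaf : Graph n → Fin n → Set
Leaf G v = ∃ (LeafAt G v)

punchIn-surjective : {i j : Fin (suc n)} → i ≢ j → ∃[ k ] j ≡ punchIn i k
punchIn-surjective i≢j = punchOut i≢j , sym (punchIn-punchOut i≢j)

-- Splitting the row and the column of `v` off the double sum leaves the arcs of `delete G v`. The
-- row has its only possibly nonzero term at `q`, and the column equals it by symmetry, so the new
-- edge enters twice.
attach : (G : Graph (suc n)) {v : Fin (suc n)} {q : Fin n} → LeafAt G v (punchIn v q) →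
  ∀ {ℓ V E} x → Counts (delete G v) ℓ V E →
  Counts G (insertAt ℓ v x) (λ a → δ x a + V a) (λ a → δ (x ⊕ ℓ q) a + E a)
attach {n} G {v} {q} (v~q , unique) {ℓ} {V} {E} x (counts c d) = counts vertices arcs
  where
  open ≡-Reasoning
  ℓ⁺ = insertAt ℓ v x
  g = arcWeight G ℓ⁺
  e = δ (x ⊕ ℓ q)
  vertices : ∀ a → vertexCount ℓ⁺ a ≡ δ x a + V a
  vertices a = trans (sum-remove {i = v} (λ u → δ (ℓ⁺ u) a))
    (cong₂ _+_ (cong (λ y → δ y a) (insertAt-lookup ℓ v x))
      (trans (sum-cong-≗ λ u → cong (λ y → δ y a) (insertAt-punchIn ℓ v x u)) (c a)))
  leafRow : ∀ a → sum (λ w → g a v (punchIn v w)) ≡ e a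
  leafRow a = begin
    sum (λ w → g a v (punchIn v w))
      ≡⟨ sum-single (λ w → g a v (punchIn v w)) q (λ w w≢q → cong (_* δ (ℓ⁺ v ⊕ ℓ⁺ (punchIn v w)) a)
           (indicator-no (Graph.adj? G v _) λ v~w → w≢q (punchIn-injective v _ _ (unique v~w)))) ⟩
    g a v (punchIn v q)
      ≡⟨ cong₂ _*_ (indicator-yes (Graph.adj? G v (punchIn v q)) v~q)
                   (cong₂ (λ y z → δ (y ⊕ z) a) (insertAt-lookup ℓ v x) (insertAt-punchIn ℓ v x q)) ⟩
    1 * e a
      ≡⟨ +-identityʳ (e a) ⟩
    e a ∎
  arcs : ∀ a → arcCount G ℓ⁺ a ≡ (e a + E a) + (e a + E a)
  arcs a = begin
    arcCount G ℓ⁺ a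
      ≡⟨ sum-remove {i = v} (λ u → sum (g a u)) ⟩
    sum (g a v) + sum (λ u → sum (g a (punchIn v u)))
      ≡⟨ cong₂ _+_
           (trans (sum-remove {i = v} (g a v)) (cong₂ _+_ (arcWeight-irrefl G ℓ⁺ a v) (leafRow a)))
           (trans (sum-cong-≗ λ u → sum-remove {i = v} (g a (punchIn v u)))
                  (∑-distrib-+ (λ u → g a (punchIn v u) v) _)) ⟩
    e a + (sum (λ u → g a (punchIn v u) v) + sum (λ u → sum (λ w → g a (punchIn v u) (punchIn v w))))
      ≡⟨ cong (e a +_) (cong₂ _+_
           (trans (sum-cong-≗ λ u → arcWeight-sym G ℓ⁺ a (punchIn v u) v) (leafRow a))
           (sum-cong-≗ λ u → sum-cong-≗ λ w → cong (indicator (Graph.adj? G (punchIn v u) (punchIn v w)) *_)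
             (cong₂ (λ y z → δ (y ⊕ z) a) (insertAt-punchIn ℓ v x u) (insertAt-punchIn ℓ v x w)))) ⟩
    e a + (e a + arcCount (delete G v) ℓ a)
      ≡⟨ cong (λ s → e a + (e a + s)) (d a) ⟩
    e a + (e a + (E a + E a))
      ≡⟨ solve 2 (λ e s → e :+ (e :+ (s :+ s)) := (e :+ s) :+ (e :+ s)) refl (e a) (E a) ⟩
    (e a + E a) + (e a + E a) ∎
    where open +-*-Solver

leafAt-irrefl : (G : Graph n) {v p : Fin n} → LeafAt G v p → v ≢ p
leafAt-irrefl G (v~p , _) refl = Graph.adj-irrefl G refl v~p

leafAt-delete : (G : Graph (suc n)) (v : Fin (suc n)) {u p : Fin n} →
  LeafAt G (punchIn v u) (punchIn v p) → LeafAt (delete G v) u p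
leafAt-delete G v (u~p , unique) = u~p , λ u~w → punchIn-injective v _ _ (unique u~w)

-- Restoring `v` adds a neighbour to `p` only, so any other vertex keeps its neighbourhood.
leaf-lift : (G : Graph (suc n)) {v : Fin (suc n)} {p u : Fin n} →
  LeafAt G v (punchIn v p) → p ≢ u → Leaf (delete G v) u → Leaf G (punchIn v u)
leaf-lift G {v} {p} {u} (_ , v-unique) p≢u (q , u~q , u-unique) = punchIn v q , u~q , unique
  where
  unique : ∀ {w} → Graph.Adj G (punchIn v u) w → w ≡ punchIn v q
  unique {w} u~w with v ≟ w
  ... | yes refl = contradiction (sym (punchIn-injective v _ _ (v-unique (Graph.adj-sym G u~w)))) p≢u
  ... | no v≢w with w′ , refl ← punchIn-surjective v≢w = cong (punchIn v) (u-unique u~w)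

module _ (G : Graph (suc n)) {v : Fin (suc n)} {q : Fin n} (leaf : LeafAt G v (punchIn v q)) where

  -- A walk may only visit v between two visits of its neighbour, so v can be cut out.
  walk-delete : ∀ {x j} → Star (Graph.Adj G) x (punchIn v j) →
    (∀ {i} → x ≡ punchIn v i → Star (Graph.Adj (delete G v)) i j) × (x ≡ v → Star (Graph.Adj (delete G v)) q j)
  walk-delete {j = j} ε =
      (λ j≡i → subst (λ i → Star _ i j) (punchIn-injective v _ _ j≡i) ε)
    , (λ j≡v → contradiction j≡v (punchInᵢ≢i v j))
  walk-delete {j = j} (_◅_ {j = y} x~y walk) with walk-delete walk
  ... | outside , inside = from-punchIn x~y , λ { refl → outside (proj₂ leaf x~y) }
    where
    from-punchIn : ∀ {x} → Graph.Adj G x y → ∀ {i} → x ≡ punchIn v i → Star (Graph.Adj (delete G v)) i j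
    from-punchIn x~y {i} refl with v ≟ y
    ... | yes refl = subst (λ k → Star _ k j)
          (sym (punchIn-injective v _ _ (proj₂ leaf (Graph.adj-sym G x~y)))) (inside refl)
    ... | no v≢y with y′ , refl ← punchIn-surjective v≢y = x~y ◅ outside refl

  delete-isTree : IsTree G → IsTree (delete G v)
  delete-isTree tree = record
    { nonEmpty  = nonZero q
    ; connected = λ i j → proj₁ (walk-delete (IsTree.connected tree (punchIn v i) (punchIn v j))) refl
    ; acyclic   = λ (k , w , w-inj , path , close) → IsTree.acyclic tree
        (k , punchIn v ∘ w , (λ eq → w-inj (punchIn-injective v _ _ eq)) , path , close)
    }
    where
    nonZero : ∀ {k} → Fin k → NonZero k
    nonZero zero    = _
    nonZero (suc _) = _

-- Existence of a leaf

IsWalk : Graph n → (Fin (suc m) → Fin n) → Set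
IsWalk {m = m} G w = ∀ (i : Fin m) → Graph.Adj G (w (inject₁ i)) (w (suc i))

-- The chord closes the initial segment of the walk into a cycle. It is phrased for `suc (suc j)`
-- because a cycle needs three vertices; `inject≤` cuts the walk off after `toℕ j + 3` of them.
chord⇒cycle : (G : Graph n) (w : Fin (2 + m) → Fin n) → Injective _≡_ _≡_ w → IsWalk G w →
  (j : Fin m) → Graph.Adj G (w (suc (suc j))) (w zero) → IsCycle G (toℕ j) (λ i → w (inject≤ i (s≤s (s≤s (toℕ<n j)))))
chord⇒cycle {m = m} G w w-inj path j chord =
    (λ eq → inject≤-injective _ _ _ _ (w-inj eq))
  , (λ i → subst (λ k → Graph.Adj G (w k) (w (suc (inject≤ i (s≤s (toℕ<n j)))))) (initial i)
               (path (inject≤ i (s≤s (toℕ<n j)))))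
  , subst (λ k → Graph.Adj G (w k) (w zero)) (sym last) chord
  where
  bound = s≤s (s≤s (toℕ<n j))
  initial : ∀ i → inject₁ (inject≤ i (s≤s (toℕ<n j))) ≡ inject≤ (inject₁ i) bound
  initial i = toℕ-injective (trans (toℕ-inject₁ _) (trans (toℕ-inject≤ i (s≤s (toℕ<n j)))
    (sym (trans (toℕ-inject≤ (inject₁ i) bound) (toℕ-inject₁ i)))))
  last : inject≤ (fromℕ (2 + toℕ j)) bound ≡ suc (suc j)
  last = toℕ-injective (trans (toℕ-inject≤ (fromℕ (2 + toℕ j)) bound) (toℕ-fromℕ (2 + toℕ j)))

-- The path is prolonged at its front while the front has a neighbour besides the second vertex.
-- Such a neighbour is new, since a chord would close a cycle; once there is none, the front is a
-- leaf. `fuel` counts the steps left before the path would have `n + 1` distinct vertices.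
longest-path-leaf : (G : Graph n) → Acyclic G → ∀ fuel (w : Fin (2 + m) → Fin n) →
  Injective _≡_ _≡_ w → IsWalk G w → fuel + (2 + m) ≡ suc n → ∃ (Leaf G)
longest-path-leaf {n} G acyclic zero w w-inj path fuel-eq =
  contradiction (subst (_≤ n) fuel-eq (injective⇒≤ w-inj)) 1+n≰n
longest-path-leaf {n} {m} G acyclic (suc fuel) w w-inj path fuel-eq
  with any? (λ u → Graph.adj? G (w zero) u ×-dec ¬? (u ≟ w (suc zero)))
... | no stuck = w zero , w (suc zero) , path zero ,
      λ {u} w₀~u → decidable-stable (u ≟ w (suc zero)) λ u≢w₁ → stuck (u , w₀~u , u≢w₁)
... | yes (u , w₀~u , u≢w₁) with any? (λ j → u ≟ w j)
...   | yes (zero , refl) = contradiction w₀~u (Graph.adj-irrefl G refl)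
...   | yes (suc zero , u≡w₁) = contradiction u≡w₁ u≢w₁
...   | yes (suc (suc j) , refl) = contradiction (_ , _ , chord⇒cycle G w w-inj path j (Graph.adj-sym G w₀~u)) acyclic
...   | no fresh = longest-path-leaf G acyclic fuel (u ∷ᵛ w) injective walk
                     (trans (+-suc fuel (2 + m)) fuel-eq)
  where
  injective : Injective _≡_ _≡_ (u ∷ᵛ w)
  injective {zero}  {zero}  _  = refl
  injective {zero}  {suc j} eq = contradiction (j , eq) fresh
  injective {suc i} {zero}  eq = contradiction (i , sym eq) fresh
  injective {suc i} {suc j} eq = cong suc (w-inj eq)
  walk : IsWalk G (u ∷ᵛ w)
  walk zero    = Graph.adj-sym G w₀~u
  walk (suc i) = path i

tree-leaf : (G : Graph (2 + n)) → IsTree G → ∃ (Leaf G)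
-- A walk between two distinct vertices has a first edge, which serves as the initial path.
tree-leaf {n} G tree with IsTree.connected tree zero (suc zero)
... | _◅_ {j = u} 0~u _ = longest-path-leaf G (IsTree.acyclic tree) (suc n) (zero ∷ᵛ u ∷ᵛ []ᵛ) injective
        (λ { zero → 0~u }) (cong suc (+-comm n 2))
  where
  0≢u : zero ≢ u
  0≢u 0≡u = Graph.adj-irrefl G 0≡u 0~u
  injective : Injective _≡_ _≡_ (zero ∷ᵛ u ∷ᵛ []ᵛ)
  injective {zero}     {zero}     _  = refl
  injective {zero}     {suc zero} eq = contradiction eq 0≢u
  injective {suc zero} {zero}     eq = contradiction (sym eq) 0≢u
  injective {suc zero} {suc zero} _  = refl

-- Isomorphisms and paths

leafAt-≅ : (G : Graph m) (H : Graph n) ((φ , _) : G ≅ H) → ∀ {v p} → LeafAt H v p → LeafAt G (φ ⟨$⟩ˡ v) (φ ⟨$⟩ˡ p)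
leafAt-≅ G H (φ , φ-adj) {v} {p} (v~p , unique) =
    from (φ-adj (φ ⟨$⟩ˡ v) (φ ⟨$⟩ˡ p)) (adj v~p)
  , λ {w} v~w → trans (sym (inverseˡ φ)) (cong (φ ⟨$⟩ˡ_)
      (unique (subst (λ u → Graph.Adj H u (φ ⟨$⟩ʳ w)) (inverseʳ φ) (to (φ-adj (φ ⟨$⟩ˡ v) w) v~w))))
  where
  open Equivalence
  adj : ∀ {u w} → Graph.Adj H u w → Graph.Adj H (φ ⟨$⟩ʳ (φ ⟨$⟩ˡ u)) (φ ⟨$⟩ʳ (φ ⟨$⟩ˡ w))
  adj u~w = subst (Graph.Adj H _) (sym (inverseʳ φ)) (subst (λ u → Graph.Adj H u _) (sym (inverseʳ φ)) u~w)

≅-sym : (G : Graph m) (H : Graph n) → G ≅ H → H ≅ G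
≅-sym G H (φ , φ-adj) = flip φ , λ u w → mk⇔
  (λ u~w → from (φ-adj _ _) (subst (Graph.Adj H _) (sym (inverseʳ φ))
    (subst (λ v → Graph.Adj H v w) (sym (inverseʳ φ)) u~w)))
  (λ u~w → subst (Graph.Adj H u) (inverseʳ φ) (subst (λ v → Graph.Adj H v _) (inverseʳ φ) (to (φ-adj _ _) u~w)))
  where open Equivalence

≅-trans : ∀ {k} (G : Graph m) (H : Graph n) (K : Graph k) → G ≅ H → H ≅ K → G ≅ K
≅-trans _ _ _ (φ , φ-adj) (ψ , ψ-adj) = φ ∘ₚ ψ , λ u w → mk⇔
  (to (ψ-adj _ _) ∘ to (φ-adj u w)) (from (φ-adj u w) ∘ from (ψ-adj _ _))
  where open Equivalence

opposite-suc-adj : (i j : Fin n) → toℕ j ≡ suc (toℕ i) → toℕ (opposite i) ≡ suc (toℕ (opposite j))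
opposite-suc-adj {n} i j j≡1+i = begin
  toℕ (opposite i)               ≡⟨ opposite-prop i ⟩
  n ∸ suc (toℕ i)                ≡⟨ cong (n ∸_) j≡1+i ⟨
  n ∸ toℕ j                      ≡⟨ ℕ.+-∸-assoc 1 (toℕ<n j) ⟩
  suc (n ∸ suc (toℕ j))          ≡⟨ cong suc (opposite-prop j) ⟨
  suc (toℕ (opposite j))         ∎
  where open ≡-Reasoning

P-reverse : ∀ n → P n ≅ P n
P-reverse n = Perm.reverse , λ i j → mk⇔ (forward i j)
  (λ adj → subst (λ k → Graph.Adj (P n) k j) (opposite-involutive i)
    (subst (Graph.Adj (P n) _) (opposite-involutive j) (forward (opposite i) (opposite j) adj)))
  where
  forward : ∀ i j → Graph.Adj (P n) i j → Graph.Adj (P n) (opposite i) (opposite j)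
  forward i j (inj₁ j≡1+i) = inj₂ (opposite-suc-adj i j j≡1+i)
  forward i j (inj₂ i≡1+j) = inj₁ (opposite-suc-adj j i i≡1+j)

P-zero-leaf : ∀ n → LeafAt (P (2 + n)) zero (suc zero)
P-zero-leaf n = inj₁ refl , λ { (inj₁ w≡1) → toℕ-injective w≡1 }

-- The new leaf becomes the front of the path and `insert v zero φ` shifts all other vertices by
-- one. Attachment at the far end reduces to this case by `P-reverse`.
P-extend : (T : Graph (2 + n)) {v : Fin (2 + n)} {q : Fin (1 + n)} → LeafAt T v (punchIn v q) →
  ((φ , _) : delete T v ≅ P (1 + n)) → φ ⟨$⟩ʳ q ≡ zero → T ≅ P (2 + n)
P-extend {n} T {v} {q} (v~q , unique) (φ , φ-adj) φq≡0 = ψ , adj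
  where
  ψ = insert v zero φ
  open Equivalence
  Image : Fin (2 + n) → Fin (2 + n) → Set
  Image x y = Graph.Adj (P (2 + n)) x y
  new : ∀ w → Graph.Adj T v (punchIn v w) ⇔ Image zero (suc (φ ⟨$⟩ʳ w))
  new w = mk⇔
    (λ v~w → inj₁ (cong suc (cong toℕ (trans (cong (φ ⟨$⟩ʳ_) (punchIn-injective v _ _ (unique v~w))) φq≡0))))
    (λ { (inj₁ eq) → subst (λ k → Graph.Adj T v (punchIn v k))
           (trans (sym (inverseˡ φ))
             (trans (cong (φ ⟨$⟩ˡ_) (trans φq≡0 (toℕ-injective (sym (suc-injective eq))))) (inverseˡ φ))) v~q
       ; (inj₂ ()) })
  old : ∀ u w → Graph.Adj T (punchIn v u) (punchIn v w) ⇔ Image (suc (φ ⟨$⟩ʳ u)) (suc (φ ⟨$⟩ʳ w))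
  old u w = mk⇔ (Sum.map (cong suc) (cong suc) ∘ to (φ-adj u w))
                (from (φ-adj u w) ∘ Sum.map suc-injective suc-injective)
  adj : ∀ u w → Graph.Adj T u w ⇔ Image (ψ ⟨$⟩ʳ u) (ψ ⟨$⟩ʳ w)
  adj u w with v ≟ u | v ≟ w
  ... | yes refl | yes refl = mk⇔ (λ v~v → contradiction v~v (Graph.adj-irrefl T refl))
                                  (λ { (inj₁ ()) ; (inj₂ ()) })
  ... | yes refl | no v≢w =
        subst (λ k → Graph.Adj T v k ⇔ Image zero (suc (φ ⟨$⟩ʳ punchOut v≢w))) (punchIn-punchOut v≢w) (new _)
  ... | no v≢u | yes refl = mk⇔
        (Sum.swap ∘ to e ∘ Graph.adj-sym T) (Graph.adj-sym T ∘ from e ∘ Sum.swap)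
    where e = subst (λ k → Graph.Adj T v k ⇔ Image zero (suc (φ ⟨$⟩ʳ punchOut v≢u))) (punchIn-punchOut v≢u) (new _)
  ... | no v≢u | no v≢w = subst (λ k → Graph.Adj T k w ⇔ Image u′ w′) (punchIn-punchOut v≢u)
        (subst (λ k → Graph.Adj T _ k ⇔ Image u′ w′) (punchIn-punchOut v≢w) (old _ _))
    where
    u′ = suc (φ ⟨$⟩ʳ punchOut v≢u)
    w′ = suc (φ ⟨$⟩ʳ punchOut v≢w)

-- Every tree is a path or has three leaves

record ThreeLeaves (G : Graph n) : Set where
  constructor threeLeaves
  field
    {v₁ v₂ v₃} : Fin n
    v₁≢v₂  : v₁ ≢ v₂
    v₁≢v₃  : v₁ ≢ v₃
    v₂≢v₃  : v₂ ≢ v₃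
    leaf₁ : Leaf G v₁
    leaf₂ : Leaf G v₂
    leaf₃ : Leaf G v₃

module _ {G : Graph (suc n)} {v : Fin (suc n)} {p : Fin n} (leaf : LeafAt G v (punchIn v p)) where

  twoLeaves-lift : {u w : Fin n} → u ≢ w → p ≢ u → p ≢ w → Leaf (delete G v) u → Leaf (delete G v) w → ThreeLeaves G
  twoLeaves-lift u≢w p≢u p≢w leafᵤ leaf_w = threeLeaves
    (punchInᵢ≢i v _ ∘ sym) (punchInᵢ≢i v _ ∘ sym) (u≢w ∘ punchIn-injective v _ _)
    (_ , leaf) (leaf-lift G leaf p≢u leafᵤ) (leaf-lift G leaf p≢w leaf_w)

  -- At most one of the three leaves is lost, namely the one to which `v` is attached, and `v`
  -- replaces it.
  threeLeaves-lift : ThreeLeaves (delete G v) → ThreeLeaves G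
  threeLeaves-lift (threeLeaves {v₁} {v₂} 1≢2 1≢3 2≢3 l₁ l₂ l₃) with p ≟ v₁ | p ≟ v₂
  ... | yes refl | _        = twoLeaves-lift 2≢3 1≢2 1≢3 l₂ l₃
  ... | no p≢1   | yes refl = twoLeaves-lift 1≢3 p≢1 2≢3 l₁ l₃
  ... | no p≢1   | no p≢2   = twoLeaves-lift 1≢2 p≢1 p≢2 l₁ l₂

-- Induction on deleting a leaf `v`. If a path remains and `v` hangs on one of its ends, the path
-- gets longer; if `v` hangs on an inner vertex, then `v` and both ends are leaves.
path-or-threeLeaves : (T : Graph (suc n)) → IsTree T → T ≅ P (suc n) ⊎ ThreeLeaves T
path-or-threeLeaves {zero} T tree = inj₁ (Perm.id , λ { zero zero → mk⇔
  (λ 0~0 → contradiction 0~0 (Graph.adj-irrefl T refl)) (λ { (inj₁ ()) ; (inj₂ ()) }) })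
path-or-threeLeaves {suc n} T tree with tree-leaf T tree
... | v , p , leaf with q , refl ← punchIn-surjective (leafAt-irrefl T leaf)
      with path-or-threeLeaves (delete T v) (delete-isTree T leaf tree)
...   | inj₂ leaves = inj₂ (threeLeaves-lift leaf leaves)
...   | inj₁ φ with proj₁ φ ⟨$⟩ʳ q ≟ zero | opposite (proj₁ φ ⟨$⟩ʳ q) ≟ zero
...     | yes φq≡0 | _ = inj₁ (P-extend T leaf φ φq≡0)
...     | no _ | yes φ′q≡0 = inj₁
          (P-extend T leaf (≅-trans (delete T v) (P (suc n)) (P (suc n)) φ (P-reverse (suc n))) φ′q≡0)
...     | no φq≢0 | no φ′q≢0 = inj₂ (ends n refl)
  where
  φ′ = ≅-trans (delete T v) (P (suc n)) (P (suc n)) φ (P-reverse (suc n))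
  ends : ∀ k → n ≡ k → ThreeLeaves T
  -- On a path with one vertex, `q` is an end; only from two vertices on are the two ends distinct
  -- leaves.
  ends zero refl = contradiction (Fin1-≡ _) φq≢0
    where
    Fin1-≡ : (i : Fin 1) → i ≡ zero
    Fin1-≡ zero = refl
  ends (suc k) refl = twoLeaves-lift leaf
    (λ eq → zero≢last (trans (sym (inverseʳ (proj₁ φ))) (trans (cong (proj₁ φ ⟨$⟩ʳ_) eq) (inverseʳ (proj₁ φ)))))
    (λ { refl → φq≢0 (inverseʳ (proj₁ φ)) }) (λ { refl → φ′q≢0 (inverseʳ (proj₁ φ′)) })
    (_ , leafAt-≅ (delete T v) (P (2 + k)) φ (P-zero-leaf k)) (_ , leafAt-≅ (delete T v) (P (2 + k)) φ′ (P-zero-leaf k))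
    where
    zero≢last : zero ≢ fromℕ (suc k)
    zero≢last ()

-- Removing three leaves at once

-- Two adjacent leaves form a whole connected component, so no walk from them reaches a third
-- vertex.
leaves-nonadjacent : (G : Graph n) → Connected G → ∀ {u v w} → u ≢ w → v ≢ w → Leaf G v → ¬ LeafAt G u v
leaves-nonadjacent G connected {u} {v} {w} u≢w v≢w (_ , _ , v-unique) (u~v , u-unique) =
  [ u≢w ∘ sym , v≢w ∘ sym ]′ (confined (connected u w) (inj₁ refl))
  where
  confined : ∀ {x} → Star (Graph.Adj G) x w → x ≡ u ⊎ x ≡ v → w ≡ u ⊎ w ≡ v
  confined ε here = here
  confined (u~y ◅ walk) (inj₁ refl) = confined walk (inj₂ (u-unique u~y))
  confined (v~y ◅ walk) (inj₂ refl) =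
    confined walk (inj₁ (trans (v-unique v~y) (sym (v-unique (Graph.adj-sym G u~v)))))

-- All three attachment vertices lie in `H`, so the three leaf labels can be chosen independently
-- and each new edge label depends on one of them only. The attachment vertices may coincide.
ThreeAttached : Graph (3 + n) → Graph n → Fin n → Fin n → Fin n → Set
ThreeAttached {n} T H q₁ q₂ q₃ = ∀ {ℓ V E} → Counts H ℓ V E → ∀ y₁ y₂ y₃ → ∃[ ℓ⁺ ] Counts T ℓ⁺
  (λ a → δ y₁ a + (δ y₂ a + (δ y₃ a + V a)))
  (λ a → δ (y₁ ⊕ ℓ q₁) a + (δ (y₂ ⊕ ℓ q₂) a + (δ (y₃ ⊕ ℓ q₃) a + E a)))

punchIn³-surjective : ∀ (v₁ : Fin (3 + n)) v₂ v₃ w → v₁ ≢ w → punchIn v₁ v₂ ≢ w → punchIn v₁ (punchIn v₂ v₃) ≢ w →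
  ∃[ q ] w ≡ punchIn v₁ (punchIn v₂ (punchIn v₃ q))
punchIn³-surjective v₁ v₂ v₃ w 1≢w 2≢w 3≢w
  with w₁ , refl ← punchIn-surjective 1≢w
  with w₂ , refl ← punchIn-surjective {i = v₂} (2≢w ∘ cong (punchIn v₁))
  with w₃ , refl ← punchIn-surjective {i = v₃} (3≢w ∘ cong (punchIn v₁ ∘ punchIn v₂))
  = w₃ , refl

-- In a connected graph with three leaves no two of these are adjacent, so their neighbours survive
-- all three deletions.
delete-threeLeaves : (T : Graph (3 + n)) → IsTree T → ThreeLeaves T →
  Σ[ H ∈ Graph n ] IsTree H × ∃[ q₁ ] ∃[ q₂ ] ∃[ q₃ ] ThreeAttached T H q₁ q₂ q₃
delete-threeLeaves T tree (threeLeaves {v₁} 1≢2 1≢3 2≢3 (p₁ , l₁) (p₂ , l₂) (p₃ , l₃))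
  with v₂ , refl ← punchIn-surjective 1≢2
  with w₃ , refl ← punchIn-surjective 1≢3
  with v₃ , refl ← punchIn-surjective {i = v₂} (2≢3 ∘ cong (punchIn v₁))
  with q₁ , refl ← punchIn³-surjective v₁ v₂ v₃ p₁ (leafAt-irrefl T l₁)
         (λ { refl → leaves-nonadjacent T (IsTree.connected tree) 1≢3 2≢3 (_ , l₂) l₁ })
         (λ { refl → leaves-nonadjacent T (IsTree.connected tree) 1≢2 (2≢3 ∘ sym) (_ , l₃) l₁ })
     | q₂ , refl ← punchIn³-surjective v₁ v₂ v₃ p₂
         (λ { refl → leaves-nonadjacent T (IsTree.connected tree) 2≢3 1≢3 (_ , l₁) l₂ })
         (leafAt-irrefl T l₂)
         (λ { refl → leaves-nonadjacent T (IsTree.connected tree) (1≢2 ∘ sym) (1≢3 ∘ sym) (_ , l₃) l₂ })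
     | q₃ , refl ← punchIn³-surjective v₁ v₂ v₃ p₃
         (λ { refl → leaves-nonadjacent T (IsTree.connected tree) (2≢3 ∘ sym) 1≢2 (_ , l₁) l₃ })
         (λ { refl → leaves-nonadjacent T (IsTree.connected tree) (1≢3 ∘ sym) (1≢2 ∘ sym) (_ , l₂) l₃ })
         (leafAt-irrefl T l₃)
  = delete T₂ v₃ , delete-isTree T₂ l₃′ (delete-isTree T₁ l₂′ (delete-isTree T l₁ tree)) , q₁ , q₂ , q₃ , attached
  where
  T₁ = delete T v₁
  T₂ = delete T₁ v₂
  l₂′ = leafAt-delete T v₁ l₂
  l₃′ = leafAt-delete T₁ v₂ (leafAt-delete T v₁ l₃)
  attached : ThreeAttached T (delete T₂ v₃) q₁ q₂ q₃
  attached {ℓ} {V} {E} c y₁ y₂ y₃ = insertAt ℓ₂ v₁ y₁ , counts (Counts.vertexCount≡ c⁺)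
    (λ a → trans (Counts.arcCount≡ c⁺ a) (cong₂ _+_ (edges a) (edges a)))
    where
    ℓ₃ = insertAt ℓ v₃ y₃
    ℓ₂ = insertAt ℓ₃ v₂ y₂
    c⁺ = attach T l₁ y₁ (attach T₁ l₂′ y₂ (attach T₂ l₃′ y₃ c))
    -- `attach` reads the neighbour's label off a labelling already extended to other leaves; at
    -- vertices of `H` this is still `ℓ`.
    edges : ∀ a → δ (y₁ ⊕ ℓ₂ (punchIn v₂ (punchIn v₃ q₁))) a + (δ (y₂ ⊕ ℓ₃ (punchIn v₃ q₂)) a + (δ (y₃ ⊕ ℓ q₃) a + E a))
                ≡ δ (y₁ ⊕ ℓ q₁) a + (δ (y₂ ⊕ ℓ q₂) a + (δ (y₃ ⊕ ℓ q₃) a + E a))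
    edges a = cong₂ (λ x z → δ (y₁ ⊕ x) a + (δ (y₂ ⊕ z) a + (δ (y₃ ⊕ ℓ q₃) a + E a)))
      (trans (insertAt-punchIn ℓ₃ v₂ y₂ _) (insertAt-punchIn ℓ v₃ y₃ q₁)) (insertAt-punchIn ℓ v₃ y₃ q₂)

-- Counts on paths

pathVertexCount : (Fin n → A) → A → ℕ
pathVertexCount {zero}  ℓ a = 0
pathVertexCount {suc n} ℓ a = δ (ℓ zero) a + pathVertexCount (ℓ ∘ suc) a

pathEdgeCount : (Fin n → A) → A → ℕ
pathEdgeCount {zero}        ℓ a = 0
pathEdgeCount {suc zero}    ℓ a = 0
pathEdgeCount {suc (suc n)} ℓ a = δ (ℓ zero ⊕ ℓ (suc zero)) a + pathEdgeCount (ℓ ∘ suc) a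

P-delete-zero : ∀ n → delete (P (2 + n)) zero ≅ P (1 + n)
P-delete-zero n = Perm.id , λ i j → mk⇔ (Sum.map suc-injective suc-injective) (Sum.map (cong suc) (cong suc))

-- The first vertex is a leaf attached to the second, so `attach` applies. Its labelling agrees with
-- `ℓ` only pointwise, hence the comparison of arc counts.
P-cons-counts : (ℓ : Fin (2 + n) → A) →
  Counts (P (1 + n)) (ℓ ∘ suc) (pathVertexCount (ℓ ∘ suc)) (pathEdgeCount (ℓ ∘ suc)) →
  Counts (P (2 + n)) ℓ (pathVertexCount ℓ) (pathEdgeCount ℓ)
P-cons-counts {n} ℓ tail = counts (Counts.vertexCount≡ c) (λ a → trans (arcs a) (Counts.arcCount≡ c a))
  where
  c = attach (P (2 + n)) {zero} (P-zero-leaf n) (ℓ zero)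
    (≅-counts (delete (P (2 + n)) zero) (P (1 + n)) (P-delete-zero n) tail)
  insertAt-head : ℓ ≗ insertAt (ℓ ∘ suc) zero (ℓ zero)
  insertAt-head zero    = refl
  insertAt-head (suc i) = refl
  arcs : ∀ a → arcCount (P (2 + n)) ℓ a ≡ arcCount (P (2 + n)) (insertAt (ℓ ∘ suc) zero (ℓ zero)) a
  arcs a = sum-cong-≗ λ u → sum-cong-≗ λ w →
    cong₂ (λ x y → indicator (Graph.adj? (P (2 + n)) u w) * δ (x ⊕ y) a) (insertAt-head u) (insertAt-head w)

P-counts : ∀ n (ℓ : Fin n → A) → Counts (P n) ℓ (pathVertexCount ℓ) (pathEdgeCount ℓ)
P-counts zero          ℓ = counts (λ _ → refl) (λ _ → refl)
P-counts (suc zero)    ℓ = counts (λ _ → refl) (λ _ → refl)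
P-counts (suc (suc n)) ℓ = P-cons-counts ℓ (P-counts (suc n) (ℓ ∘ suc))

-- Finite searches over ℤ₂²

∀A? : {Q : A → Set} → (∀ a → Dec (Q a)) → Dec (∀ a → Q a)
∀A? Q? = map′
  (λ { (q₀ , q₁ , q₂ , q₃) (0ℙ , 0ℙ) → q₀ ; (q₀ , q₁ , q₂ , q₃) (0ℙ , 1ℙ) → q₁
     ; (q₀ , q₁ , q₂ , q₃) (1ℙ , 0ℙ) → q₂ ; (q₀ , q₁ , q₂ , q₃) (1ℙ , 1ℙ) → q₃ })
  (λ q → q _ , q _ , q _ , q _)
  (Q? (0ℙ , 0ℙ) ×-dec Q? (0ℙ , 1ℙ) ×-dec Q? (1ℙ , 0ℙ) ×-dec Q? (1ℙ , 1ℙ))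

∃A? : {Q : A → Set} → (∀ a → Dec (Q a)) → Dec (∃ Q)
∃A? Q? = map′
  [ (λ q → _ , q) , [ (λ q → _ , q) , [ (λ q → _ , q) , (λ q → _ , q) ]′ ]′ ]′
  (λ { ((0ℙ , 0ℙ) , q) → inj₁ q ; ((0ℙ , 1ℙ) , q) → inj₂ (inj₁ q)
     ; ((1ℙ , 0ℙ) , q) → inj₂ (inj₂ (inj₁ q)) ; ((1ℙ , 1ℙ) , q) → inj₂ (inj₂ (inj₂ q)) })
  (Q? (0ℙ , 0ℙ) ⊎-dec Q? (0ℙ , 1ℙ) ⊎-dec Q? (1ℙ , 0ℙ) ⊎-dec Q? (1ℙ , 1ℙ))

pattern o = 0ℙ , 0ℙ
pattern α = 0ℙ , 1ℙ
pattern β = 1ℙ , 0ℙ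
pattern γ = 1ℙ , 1ℙ

opaque
  unfolding δ

  δ-⊕-cancel : ∀ h b a → δ ((h ⊕ b) ⊕ b) a ≡ δ h a
  δ-⊕-cancel = from-yes (∀A? λ h → ∀A? λ b → ∀A? λ a → δ ((h ⊕ b) ⊕ b) a ℕ.≟ δ h a)

  δ≤1 : ∀ h a → δ h a ≤ 1
  δ≤1 = from-yes (∀A? λ h → ∀A? λ a → δ h a ≤? 1)

  -- Distinctness of labels is expressed by a bound on sums of `δ`, the form in which it enters the
  -- counts.
  another-label : ∀ u → ∃[ w ] ∀ a → δ w a + δ u a ≤ 1
  another-label = from-yes (∀A? λ u → ∃A? λ w → ∀A? λ a → δ w a + δ u a ≤? 1)

  -- Two labels besides `u` and `w` are available. Translation by `b` keeps them distinct, so at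
  -- most one of them produces the edge label `e`.
  third-label : ∀ u w → (∀ a → δ u a + δ w a ≤ 1) → ∀ e b →
    ∃[ v ] (∀ a → δ v a + (δ u a + δ w a) ≤ 1) × (∀ a → δ (v ⊕ b) a + δ e a ≤ 1)
  third-label = from-yes (∀A? λ u → ∀A? λ w → (∀A? λ a → δ u a + δ w a ≤? 1) →-dec ∀A? λ e → ∀A? λ b →
    ∃A? λ v → (∀A? λ a → δ v a + (δ u a + δ w a) ≤? 1) ×-dec (∀A? λ a → δ (v ⊕ b) a + δ e a ≤? 1))

  -- This is Hall's theorem for the group ℤ₂²: there is a permutation π of the group such that π i ⊕ bᵢ is
  -- again a permutation as soon as the four bᵢ sum to zero; the free fourth value u is adjusted by translating π.
  three-labels : ∀ u b₁ b₂ b₃ → ∃[ y₁ ] ∃[ y₂ ] ∃[ y₃ ]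
      (∀ a → δ y₁ a + (δ y₂ a + (δ y₃ a + δ u a)) ≡ 1)
    × (∀ a → δ (u ⊕ (b₁ ⊕ (b₂ ⊕ b₃))) a + (δ (y₁ ⊕ b₁) a + (δ (y₂ ⊕ b₂) a + δ (y₃ ⊕ b₃) a)) ≡ 1)
  three-labels = from-yes (∀A? λ u → ∀A? λ b₁ → ∀A? λ b₂ → ∀A? λ b₃ → ∃A? λ y₁ → ∃A? λ y₂ → ∃A? λ y₃ →
    (∀A? λ a → δ y₁ a + (δ y₂ a + (δ y₃ a + δ u a)) ℕ.≟ 1) ×-dec
    (∀A? λ a → δ (u ⊕ (b₁ ⊕ (b₂ ⊕ b₃))) a + (δ (y₁ ⊕ b₁) a + (δ (y₂ ⊕ b₂) a + δ (y₃ ⊕ b₃) a)) ℕ.≟ 1))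

module _ (ℓ : Fin n → A) (q₁ q₂ q₃ : Fin n) (y₁ y₂ y₃ a : A) where

  vertexCount₊₃ edgeCount₊₃ : ℕ
  vertexCount₊₃ = δ y₁ a + (δ y₂ a + (δ y₃ a + pathVertexCount ℓ a))
  edgeCount₊₃   = δ (y₁ ⊕ ℓ q₁) a + (δ (y₂ ⊕ ℓ q₂) a + (δ (y₃ ⊕ ℓ q₃) a + pathEdgeCount ℓ a))

P₂-label : Fin 2 → A
P₂-label = o ∷ᵛ α ∷ᵛ []ᵛ

P₃-label : Fin 3 → A
P₃-label = o ∷ᵛ α ∷ᵛ β ∷ᵛ []ᵛ

-- None of the four is balanced, as P₅ has no balanced labelling. For each triple of attachment
-- vertices the search finds one whose defects three leaves can repair.
P₅-labels : Fin 4 → Fin 5 → A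
P₅-labels = (o ∷ᵛ o ∷ᵛ α ∷ᵛ α ∷ᵛ β ∷ᵛ []ᵛ) ∷ᵛ (o ∷ᵛ α ∷ᵛ α ∷ᵛ β ∷ᵛ β ∷ᵛ []ᵛ)
         ∷ᵛ (o ∷ᵛ α ∷ᵛ α ∷ᵛ β ∷ᵛ γ ∷ᵛ []ᵛ) ∷ᵛ (o ∷ᵛ α ∷ᵛ β ∷ᵛ β ∷ᵛ γ ∷ᵛ []ᵛ) ∷ᵛ []ᵛ

opaque
  unfolding δ

  P₂₊₃ : ∀ q₁ q₂ q₃ → ∃[ y₁ ] ∃[ y₂ ] ∃[ y₃ ] (∀ a → edgeCount₊₃ P₂-label q₁ q₂ q₃ y₁ y₂ y₃ a ≡ 1) ×
    ∃[ u ] ∀ a → vertexCount₊₃ P₂-label q₁ q₂ q₃ y₁ y₂ y₃ a ≡ δ u a + 1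
  P₂₊₃ = from-yes (all? λ q₁ → all? λ q₂ → all? λ q₃ → ∃A? λ y₁ → ∃A? λ y₂ → ∃A? λ y₃ →
    (∀A? λ a → edgeCount₊₃ P₂-label q₁ q₂ q₃ y₁ y₂ y₃ a ℕ.≟ 1) ×-dec
    ∃A? λ u → ∀A? λ a → vertexCount₊₃ P₂-label q₁ q₂ q₃ y₁ y₂ y₃ a ℕ.≟ δ u a + 1)

  P₃₊₃ : ∀ q₁ q₂ q₃ → ∃[ y₁ ] ∃[ y₂ ] ∃[ y₃ ]
    (∃[ e ] ∀ a → edgeCount₊₃ P₃-label q₁ q₂ q₃ y₁ y₂ y₃ a ≡ δ e a + 1) ×
    ∃[ u ] ∃[ w ] (∀ a → δ u a + δ w a ≤ 1) × ∀ a → vertexCount₊₃ P₃-label q₁ q₂ q₃ y₁ y₂ y₃ a ≡ δ u a + (δ w a + 1)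
  P₃₊₃ = from-yes (all? λ q₁ → all? λ q₂ → all? λ q₃ → ∃A? λ y₁ → ∃A? λ y₂ → ∃A? λ y₃ →
    (∃A? λ e → ∀A? λ a → edgeCount₊₃ P₃-label q₁ q₂ q₃ y₁ y₂ y₃ a ℕ.≟ δ e a + 1) ×-dec
    ∃A? λ u → ∃A? λ w → (∀A? λ a → δ u a + δ w a ≤? 1) ×-dec
      (∀A? λ a → vertexCount₊₃ P₃-label q₁ q₂ q₃ y₁ y₂ y₃ a ℕ.≟ δ u a + (δ w a + 1)))

  P₅₊₃ : ∀ q₁ q₂ q₃ → ∃[ i ] ∃[ y₁ ] ∃[ y₂ ] ∃[ y₃ ] (∀ a → vertexCount₊₃ (P₅-labels i) q₁ q₂ q₃ y₁ y₂ y₃ a ≡ 2) ×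
    ∃[ h ] ∀ a → δ h a + edgeCount₊₃ (P₅-labels i) q₁ q₂ q₃ y₁ y₂ y₃ a ≡ 2
  P₅₊₃ = from-yes (all? λ q₁ → all? λ q₂ → all? λ q₃ → any? λ i → ∃A? λ y₁ → ∃A? λ y₂ → ∃A? λ y₃ →
    (∀A? λ a → vertexCount₊₃ (P₅-labels i) q₁ q₂ q₃ y₁ y₂ y₃ a ℕ.≟ 2) ×-dec
    ∃A? λ h → ∀A? λ a → δ h a + edgeCount₊₃ (P₅-labels i) q₁ q₂ q₃ y₁ y₂ y₃ a ℕ.≟ 2)

P₆-label : Fin 6 → A
P₆-label = o ∷ᵛ o ∷ᵛ α ∷ᵛ β ∷ᵛ α ∷ᵛ γ ∷ᵛ []ᵛ

-- `P₆-label` continued by `γ` and `β`. Starting with `o` is what allows periods to be prepended.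
P₈-label : Fin 8 → A
P₈-label = o ∷ᵛ o ∷ᵛ α ∷ᵛ β ∷ᵛ α ∷ᵛ γ ∷ᵛ γ ∷ᵛ β ∷ᵛ []ᵛ

P₁₂-label : Fin 12 → A
P₁₂-label = o ∷ᵛ o ∷ᵛ o ∷ᵛ α ∷ᵛ β ∷ᵛ α ∷ᵛ β ∷ᵛ γ ∷ᵛ α ∷ᵛ γ ∷ᵛ γ ∷ᵛ β ∷ᵛ []ᵛ

opaque
  unfolding δ

  δo+δα≤1 : ∀ a → δ o a + δ α a ≤ 1
  δo+δα≤1 = from-yes (∀A? λ a → δ o a + δ α a ≤? 1)

  P₆-vertices : ∀ a → pathVertexCount P₆-label a ≡ δ o a + (δ α a + 1)
  P₆-vertices = from-yes (∀A? λ a → pathVertexCount P₆-label a ℕ.≟ δ o a + (δ α a + 1))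

  P₆-edges : ∀ a → pathEdgeCount P₆-label a ≡ δ γ a + 1
  P₆-edges = from-yes (∀A? λ a → pathEdgeCount P₆-label a ℕ.≟ δ γ a + 1)

  P₈-vertices : ∀ a → pathVertexCount P₈-label a ≡ 2
  P₈-vertices = from-yes (∀A? λ a → pathVertexCount P₈-label a ℕ.≟ 2)

  P₈-edges : ∃[ h ] ∀ a → δ h a + pathEdgeCount P₈-label a ≡ 2
  P₈-edges = from-yes (∃A? λ h → ∀A? λ a → δ h a + pathEdgeCount P₈-label a ℕ.≟ 2)

  P₁₂-vertices : ∀ a → pathVertexCount P₁₂-label a ≡ 3
  P₁₂-vertices = from-yes (∀A? λ a → pathVertexCount P₁₂-label a ℕ.≟ 3)

  P₁₂-edges : ∃[ h ] ∀ a → δ h a + pathEdgeCount P₁₂-label a ≡ 3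
  P₁₂-edges = from-yes (∃A? λ h → ∀A? λ a → δ h a + pathEdgeCount P₁₂-label a ℕ.≟ 3)

  period-vertices : ∀ a s → δ o a + (δ β a + (δ γ a + (δ γ a + (δ α a + (δ β a + (δ α a + (δ o a + s))))))) ≡ 2 + s
  period-vertices o s = refl
  period-vertices α s = refl
  period-vertices β s = refl
  period-vertices γ s = refl

  -- The last `δ o a` is the edge joining the period to the old path: both of its ends are labelled
  -- `o`.
  period-edges : ∀ a s → δ β a + (δ α a + (δ o a + (δ β a + (δ γ a + (δ γ a + (δ α a + (δ o a + s))))))) ≡ 2 + s
  period-edges o s = refl
  period-edges α s = refl
  period-edges β s = refl
  period-edges γ s = refl

AlmostConstant : (A → ℕ) → Set
AlmostConstant f = ∀ a b → ∣ f a - f b ∣ ≤ 1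

almostConstant? : ∀ f → Dec (AlmostConstant f)
almostConstant? f = ∀A? λ a → ∀A? λ b → ∣ f a - f b ∣ ≤? 1

opaque
  unfolding δ

  -- Balance makes the four vertex labels distinct, so they sum to zero and `a ⊕ b` equals `c ⊕ d`;
  -- but three edges must have distinct labels.
  P₄-unbalanced : ∀ a b c d → let ℓ = a ∷ᵛ b ∷ᵛ c ∷ᵛ d ∷ᵛ []ᵛ in
    ¬ (AlmostConstant (pathVertexCount ℓ) × AlmostConstant (pathEdgeCount ℓ))
  P₄-unbalanced = from-yes (∀A? λ a → ∀A? λ b → ∀A? λ c → ∀A? λ d → let ℓ = a ∷ᵛ b ∷ᵛ c ∷ᵛ d ∷ᵛ []ᵛ in
    ¬? (almostConstant? (pathVertexCount ℓ) ×-dec almostConstant? (pathEdgeCount ℓ)))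

  -- Balance makes each edge label occur once, so the edge labels sum to zero and `a` equals `e`.
  -- The edge labelled `o` needs two equal adjacent vertices, but only one pair of vertices may
  -- share a label.
  P₅-unbalanced : ∀ a b c d e → let ℓ = a ∷ᵛ b ∷ᵛ c ∷ᵛ d ∷ᵛ e ∷ᵛ []ᵛ in
    ¬ (AlmostConstant (pathVertexCount ℓ) × AlmostConstant (pathEdgeCount ℓ))
  P₅-unbalanced = from-yes (∀A? λ a → ∀A? λ b → ∀A? λ c → ∀A? λ d → ∀A? λ e → let ℓ = a ∷ᵛ b ∷ᵛ c ∷ᵛ d ∷ᵛ e ∷ᵛ []ᵛ in
    ¬? (almostConstant? (pathVertexCount ℓ) ×-dec almostConstant? (pathEdgeCount ℓ)))

-- Balanced counts and cordiality

counts-cong : {G : Graph n} {ℓ : Fin n → A} {V V′ E E′ : A → ℕ} → V ≗ V′ → E ≗ E′ → Counts G ℓ V E → Counts G ℓ V′ E′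
counts-cong V≗ E≗ (counts c d) = counts (λ a → trans (c a) (V≗ a)) (λ a → trans (d a) (cong₂ _+_ (E≗ a) (E≗ a)))

Balanced : (A → ℕ) → Set
Balanced f = ∃[ k ] ∀ a → k ≤ f a × f a ≤ suc k

balanced⇒almostConstant : ∀ f → Balanced f → AlmostConstant f
balanced⇒almostConstant f (k , bounds) a b = go (bounds a) (bounds b)
  where
  go : ∀ {k s t} → k ≤ s × s ≤ suc k → k ≤ t × t ≤ suc k → ∣ s - t ∣ ≤ 1
  go {s = zero}  {t}     (z≤n , _) (_ , t≤1) = t≤1
  go {s = suc s} {zero}  (_ , s≤1) (z≤n , _) = s≤1
  go {k = zero}  {suc s} {suc t} (_ , s≤s s≤0) (_ , s≤s t≤0) =
    ≤-trans (ℕ.∣m-n∣≤m⊔n s t) (≤-trans (ℕ.⊔-lub s≤0 t≤0) z≤n)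
  go {k = suc k} {suc s} {suc t} (s≤s k≤s , s≤s s≤) (s≤s k≤t , s≤s t≤) = go (k≤s , s≤) (k≤t , t≤)

almostConstant-cong : ∀ f g → f ≗ g → AlmostConstant g → AlmostConstant f
almostConstant-cong f g f≗g g-ac a b = subst (_≤ 1) (sym (cong₂ ∣_-_∣ (f≗g a) (f≗g b))) (g-ac a b)

constant-balanced : ∀ k → Balanced (λ _ → k)
constant-balanced k = k , λ _ → ≤-refl , ℕ.n≤1+n k

δ+-balanced : ∀ u k → Balanced (λ a → δ u a + k)
δ+-balanced u k = k , λ a → ℕ.m≤n+m k (δ u a) , ℕ.+-monoˡ-≤ k (δ≤1 u a)

δ+δ+-balanced : ∀ u w k → (∀ a → δ u a + δ w a ≤ 1) → Balanced (λ a → δ u a + (δ w a + k))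
δ+δ+-balanced u w k u+w≤1 = k , λ a →
    ≤-trans (ℕ.m≤n+m k (δ w a)) (ℕ.m≤n+m _ (δ u a))
  , ≤-trans (≤-reflexive (sym (+-assoc (δ u a) _ k))) (ℕ.+-monoˡ-≤ k (u+w≤1 a))

double-injective : ∀ {s t} → s + s ≡ t + t → s ≡ t
double-injective {zero}  {zero}  _  = refl
double-injective {suc s} {suc t} eq =
  cong suc (double-injective (suc-injective (trans (sym (+-suc s s)) (trans (suc-injective eq) (+-suc t t)))))

balanced⇒cordial : {G : Graph n} {ℓ : Fin n → A} {V E : A → ℕ} →
  Counts G ℓ V E → Balanced V → Balanced E → ℤ₂²-Cordial G
balanced⇒cordial {G = G} {ℓ} {V} {E} (counts c d) V-bal E-bal = ℓ ,
    almostConstant-cong (f-V G ℓ) V (λ a → trans (f-V≡vertexCount G ℓ a) (c a)) (balanced⇒almostConstant V V-bal)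
  , almostConstant-cong (f-E G ℓ) E (λ a → double-injective (trans (f-E-double G ℓ a) (d a)))
                        (balanced⇒almostConstant E E-bal)

-- P₄ and P₅ are not cordial

cordial-path : (T : Graph m) → T ≅ P n → ℤ₂²-Cordial T →
  Σ[ ℓ ∈ (Fin n → A) ] AlmostConstant (pathVertexCount ℓ) × AlmostConstant (pathEdgeCount ℓ)
cordial-path {n = n} T φ (ℓ , V-bal , E-bal) = ℓ′ ,
    almostConstant-cong (pathVertexCount ℓ′) (f-V T ℓ)
      (λ a → trans (sym (Counts.vertexCount≡ c a)) (Counts.vertexCount≡ c′ a)) V-bal
  , almostConstant-cong (pathEdgeCount ℓ′) (f-E T ℓ)
      (λ a → double-injective (trans (sym (Counts.arcCount≡ c a)) (Counts.arcCount≡ c′ a))) E-bal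
  where
  ℓ′ = ℓ ∘ (proj₁ φ ⟨$⟩ˡ_)
  c = P-counts n ℓ′
  c′ : Counts (P n) ℓ′ (f-V T ℓ) (f-E T ℓ)
  c′ = ≅-counts (P n) T (≅-sym T (P n) φ) {ℓ}
    (counts (λ a → sym (f-V≡vertexCount T ℓ a)) (λ a → sym (f-E-double T ℓ a)))

≅P₄⇒¬cordial : (T : Graph n) → T ≅ P 4 → ¬ ℤ₂²-Cordial T
≅P₄⇒¬cordial T φ cordial =
  let ℓ , bal = cordial-path T φ cordial in P₄-unbalanced (ℓ 0F) (ℓ 1F) (ℓ 2F) (ℓ 3F) bal

≅P₅⇒¬cordial : (T : Graph n) → T ≅ P 5 → ¬ ℤ₂²-Cordial T
≅P₅⇒¬cordial T φ cordial =
  let ℓ , bal = cordial-path T φ cordial in P₅-unbalanced (ℓ 0F) (ℓ 1F) (ℓ 2F) (ℓ 3F) (ℓ 4F) bal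

-- Labellings by number of vertices modulo 4

-- A balanced labelling of a tree on 4k, 4k + 1 and 4k + 2 vertices, respectively, has counts of the following shape.
Labelling₀ Labelling₁ Labelling₂ : ℕ → Graph n → Set
Labelling₀ k G = ∃[ ℓ ] ∃[ E ] ∃[ h ] Counts G ℓ (λ _ → k) E × (∀ a → δ h a + E a ≡ k)
Labelling₁ k G = ∃[ ℓ ] ∃[ u ] Counts G ℓ (λ a → δ u a + k) (λ _ → k)
Labelling₂ k G = ∃[ ℓ ] ∃[ u ] ∃[ w ] ∃[ e ]
  Counts G ℓ (λ a → δ u a + (δ w a + k)) (λ a → δ e a + k) × (∀ a → δ u a + δ w a ≤ 1)

-- There is one edge fewer than vertices: `h` is the label that occurs on `k` edges, every other
-- label occurring on `suc k`.
labelling₀⇒cordial : ∀ {k} {G : Graph n} → Labelling₀ (suc k) G → ℤ₂²-Cordial G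
labelling₀⇒cordial {k = k} (ℓ , E , h , c , h+E) = balanced⇒cordial c (constant-balanced (suc k))
  (k , λ a → s≤s⁻¹ (≤-trans (≤-reflexive (sym (h+E a))) (ℕ.+-monoˡ-≤ (E a) (δ≤1 h a)))
           , ≤-trans (ℕ.m≤n+m (E a) (δ h a)) (≤-reflexive (h+E a)))

labelling₁⇒cordial : ∀ {k} {G : Graph n} → Labelling₁ k G → ℤ₂²-Cordial G
labelling₁⇒cordial {k = k} (ℓ , u , c) = balanced⇒cordial c (δ+-balanced u k) (constant-balanced k)

labelling₂⇒cordial : ∀ {k} {G : Graph n} → Labelling₂ k G → ℤ₂²-Cordial G
labelling₂⇒cordial {k = k} (ℓ , u , w , e , c , u+w≤1) =
  balanced⇒cordial c (δ+δ+-balanced u w k u+w≤1) (δ+-balanced e k)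

module _ (G : Graph (suc n)) {v : Fin (suc n)} {q : Fin n} (leaf : LeafAt G v (punchIn v q)) {k : ℕ} where

  -- The new edge must carry the missing label `h`, which forces the leaf label. Any leaf label is
  -- harmless for the vertices, whose classes all have size `k`.
  labelling₀₊₁ : Labelling₀ k (delete G v) → Labelling₁ k G
  labelling₀₊₁ (ℓ , E , h , c , h+E) = _ , h ⊕ ℓ q ,
    counts-cong (λ _ → refl) (λ a → trans (cong (_+ E a) (δ-⊕-cancel h (ℓ q) a)) (h+E a)) (attach G leaf (h ⊕ ℓ q) c)

  -- All edge labels are equally frequent, so the leaf only has to avoid `u`.
  labelling₁₊₁ : Labelling₁ k (delete G v) → Labelling₂ k G
  labelling₁₊₁ (ℓ , u , c) with w , w+u≤1 ← another-label u = _ , w , u , w ⊕ ℓ q , attach G leaf w c , w+u≤1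

  -- The leaf has to avoid `u` and `w`, and its edge has to avoid `e`.
  labelling₂₊₁⇒cordial : Labelling₂ k (delete G v) → ℤ₂²-Cordial G
  labelling₂₊₁⇒cordial (ℓ , u , w , e , c , u+w≤1) with third-label u w u+w≤1 e (ℓ q)
  ... | s , s+u+w≤1 , s+e≤1 = balanced⇒cordial (attach G leaf s c)
    (k , λ a → ≤-trans (ℕ.m≤n+m k (δ w a)) (≤-trans (ℕ.m≤n+m _ (δ u a)) (ℕ.m≤n+m _ (δ s a)))
             , ≤-trans (≤-reflexive (regroup (δ s a) (δ u a) (δ w a))) (ℕ.+-monoˡ-≤ k (s+u+w≤1 a)))
    (δ+δ+-balanced (s ⊕ ℓ q) e k s+e≤1)
    where
    regroup : ∀ r s t → r + (s + (t + k)) ≡ (r + (s + t)) + k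
    regroup r s t = solve 4 (λ r s t k → r :+ (s :+ (t :+ k)) := (r :+ (s :+ t)) :+ k) refl r s t k
      where open +-*-Solver

labelling₁₊₃ : ∀ {k} {T : Graph (3 + n)} {H : Graph n} {q₁ q₂ q₃} → ThreeAttached T H q₁ q₂ q₃ →
  Labelling₁ k H → Labelling₀ (suc k) T
labelling₁₊₃ {k = k} {q₁ = q₁} {q₂} {q₃} attached (ℓ , u , c)
  with y₁ , y₂ , y₃ , V≡1 , E≡1 ← three-labels u (ℓ q₁) (ℓ q₂) (ℓ q₃)
  with ℓ⁺ , c⁺ ← attached c y₁ y₂ y₃
  -- The elements of ℤ₂² sum to zero, so the leaves, which carry the labels other than `u`, sum to
  -- `u`. The edge label missed by the three new edges is the sum of their labels, which is this
  -- element.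
  = ℓ⁺ , _ , u ⊕ (ℓ q₁ ⊕ (ℓ q₂ ⊕ ℓ q₃))
  , counts-cong (λ a → trans (regroup (δ y₁ a) (δ y₂ a) (δ y₃ a) (δ u a)) (cong (_+ k) (V≡1 a))) (λ _ → refl) c⁺
  , λ a → trans (regroup (δ (u ⊕ (ℓ q₁ ⊕ (ℓ q₂ ⊕ ℓ q₃))) a) (δ (y₁ ⊕ ℓ q₁) a) (δ (y₂ ⊕ ℓ q₂) a) (δ (y₃ ⊕ ℓ q₃) a))
                (cong (_+ k) (E≡1 a))
  where
  regroup : ∀ r s t u → r + (s + (t + (u + k))) ≡ (r + (s + (t + u))) + k
  regroup r s t u = solve 5 (λ r s t u k → r :+ (s :+ (t :+ (u :+ k))) := (r :+ (s :+ (t :+ u))) :+ k) refl r s t u k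
    where open +-*-Solver

-- Explicit labellings of long paths

-- Prepending o β γ γ α β α o to a labelling starting with o uses each vertex label and each edge label twice.
P-labelling : ∀ k → Σ[ ℓ ∈ (Fin (8 + k * 4) → A) ] ℓ zero ≡ o × (∀ a → pathVertexCount ℓ a ≡ 2 + k)
  × ∃[ h ] ∀ a → δ h a + pathEdgeCount ℓ a ≡ 2 + k
P-labelling zero       = P₈-label , refl , P₈-vertices , P₈-edges
-- Sizes grow by 4 but the period is 8, so a second start is needed, on 12 vertices.
P-labelling (suc zero) = P₁₂-label , refl , P₁₂-vertices , P₁₂-edges
P-labelling (suc (suc k)) with P-labelling k
... | ℓ , ℓ₀≡o , V≡ , h , E≡ =
  o ∷ᵛ β ∷ᵛ γ ∷ᵛ γ ∷ᵛ α ∷ᵛ β ∷ᵛ α ∷ᵛ o ∷ᵛ ℓ , refl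
  , (λ a → trans (period-vertices a (pathVertexCount ℓ a)) (cong (2 +_) (V≡ a)))
  -- Knowing `ℓ zero` fixes the label of the joining edge; `h` stays the missing label, since a
  -- period uses all edge labels equally often.
  , h , λ a → trans (cong (δ h a +_) (trans
      (cong (λ l → δ β a + (δ α a + (δ o a + (δ β a + (δ γ a + (δ γ a + (δ α a + (δ (o ⊕ l) a + pathEdgeCount ℓ a))))))))
            ℓ₀≡o)
      (period-edges a (pathEdgeCount ℓ a))))
    (trans (+-comm (δ h a) _) (cong (2 +_) (trans (+-comm (pathEdgeCount ℓ a) _) (E≡ a))))

P-size : {T : Graph m} → T ≅ P n → m ≡ n
P-size (φ , _) = ↔⇒≡ φ

P-labelling₀ : ∀ k (T : Graph n) → T ≅ P (8 + k * 4) → Labelling₀ (2 + k) T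
P-labelling₀ k T φ =
  let ℓ , _ , V≡ , h , E≡ = P-labelling k
  in _ , _ , h , counts-cong V≡ (λ _ → refl) (≅-counts T (P (8 + k * 4)) φ (P-counts (8 + k * 4) ℓ)) , E≡

P₆-labelling : (T : Graph n) → T ≅ P 6 → Labelling₂ 1 T
P₆-labelling T φ = _ , o , α , γ , counts-cong P₆-vertices P₆-edges (≅-counts T (P 6) φ (P-counts 6 P₆-label)) , δo+δα≤1

-- Three leaves on a short path

no-threeLeaves-2 : {G : Graph 2} → ¬ ThreeLeaves G
no-threeLeaves-2 (threeLeaves 1≢2 1≢3 2≢3 _ _ _) with punchIn-surjective 1≢2 | punchIn-surjective 1≢3
... | zero , refl | zero , refl = 2≢3 refl

tree₂≅P₂ : (T : Graph 2) → IsTree T → T ≅ P 2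
tree₂≅P₂ T tree with path-or-threeLeaves T tree
... | inj₁ φ = φ
... | inj₂ leaves = contradiction leaves no-threeLeaves-2

tree₃≅P₃ : (T : Graph 3) → IsTree T → T ≅ P 3
tree₃≅P₃ T tree with path-or-threeLeaves T tree
... | inj₁ φ = φ
-- Without the three leaves no vertex would remain for them to hang on.
... | inj₂ leaves with _ , _ , () , _ ← delete-threeLeaves T tree leaves

module _ {T : Graph (3 + n)} {H : Graph n} {q₁ q₂ q₃} (attached : ThreeAttached T H q₁ q₂ q₃) where

  path₊₃-counts : (φ : H ≅ P m) (ℓ : Fin m → A) → ∀ y₁ y₂ y₃ → ∃[ ℓ⁺ ] Counts T ℓ⁺
    (vertexCount₊₃ ℓ (proj₁ φ ⟨$⟩ʳ q₁) (proj₁ φ ⟨$⟩ʳ q₂) (proj₁ φ ⟨$⟩ʳ q₃) y₁ y₂ y₃)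
    (edgeCount₊₃ ℓ (proj₁ φ ⟨$⟩ʳ q₁) (proj₁ φ ⟨$⟩ʳ q₂) (proj₁ φ ⟨$⟩ʳ q₃) y₁ y₂ y₃)
  path₊₃-counts {m} φ ℓ = attached (≅-counts H (P m) φ (P-counts m ℓ))

  P₂₊₃-labelling : H ≅ P 2 → Labelling₁ 1 T
  P₂₊₃-labelling φ =
    let y₁ , y₂ , y₃ , E≡ , u , V≡ = P₂₊₃ (proj₁ φ ⟨$⟩ʳ q₁) (proj₁ φ ⟨$⟩ʳ q₂) (proj₁ φ ⟨$⟩ʳ q₃)
        ℓ⁺ , c = path₊₃-counts φ P₂-label y₁ y₂ y₃
    in ℓ⁺ , u , counts-cong V≡ E≡ c

  P₃₊₃-labelling : H ≅ P 3 → Labelling₂ 1 T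
  P₃₊₃-labelling φ =
    let y₁ , y₂ , y₃ , (e , E≡) , u , w , u+w≤1 , V≡ = P₃₊₃ (proj₁ φ ⟨$⟩ʳ q₁) (proj₁ φ ⟨$⟩ʳ q₂) (proj₁ φ ⟨$⟩ʳ q₃)
        ℓ⁺ , c = path₊₃-counts φ P₃-label y₁ y₂ y₃
    in ℓ⁺ , u , w , e , counts-cong V≡ E≡ c , u+w≤1

  P₅₊₃-labelling : H ≅ P 5 → Labelling₀ 2 T
  P₅₊₃-labelling φ =
    let i , y₁ , y₂ , y₃ , V≡ , h , E≡ = P₅₊₃ (proj₁ φ ⟨$⟩ʳ q₁) (proj₁ φ ⟨$⟩ʳ q₂) (proj₁ φ ⟨$⟩ʳ q₃)
        ℓ⁺ , c = path₊₃-counts φ (P₅-labels i) y₁ y₂ y₃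
    in ℓ⁺ , _ , h , counts-cong V≡ (λ _ → refl) c , E≡

-- Induction on the number of vertices

tree-delete-leaf : (T : Graph (2 + n)) → IsTree T → ∃[ v ] ∃[ q ] LeafAt T v (punchIn v q) × IsTree (delete T v)
tree-delete-leaf T tree with v , p , leaf ← tree-leaf T tree
  with q , refl ← punchIn-surjective (leafAt-irrefl T leaf) = v , q , leaf , delete-isTree T leaf tree

-- Comparing sizes leaves only `k` equal to 1, the trees on eight vertices.
labelling₀-of-P₅₊₃ : ∀ k {T : Graph (4 + k * 4)} {H : Graph (1 + k * 4)} {q₁ q₂ q₃} → ThreeAttached T H q₁ q₂ q₃ →
  H ≅ P 5 → Labelling₀ (suc k) T
labelling₀-of-P₅₊₃ zero          {H = H} _ φ = contradiction (P-size {T = H} φ) λ ()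
labelling₀-of-P₅₊₃ (suc zero)    attached  φ = P₅₊₃-labelling attached φ
labelling₀-of-P₅₊₃ (suc (suc k)) {H = H} _ φ = contradiction (P-size {T = H} φ) λ ()

mutual

  -- On five vertices deleting one leaf could leave P₄, so a branched tree is reduced to P₂ instead.
  -- From nine vertices on, the smaller tree has at least eight and is not P₄.
  tree₁ : ∀ k (T : Graph (1 + k * 4)) → IsTree T → T ≅ P 5 ⊎ Labelling₁ k T
  tree₁ zero T tree = inj₂ ((λ _ → o) , o , counts (λ _ → refl)
    λ a → trans (+-identityʳ _) (trans (+-identityʳ _) (arcWeight-irrefl T (λ _ → o) a zero)))
  tree₁ (suc zero) T tree = Sum.map₂ branched (path-or-threeLeaves T tree)
    where
    branched : ThreeLeaves T → Labelling₁ 1 T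
    branched leaves =
      let H , H-tree , _ , _ , _ , attached = delete-threeLeaves T tree leaves
      in P₂₊₃-labelling attached (tree₂≅P₂ H H-tree)
  tree₁ (suc (suc k)) T tree =
    let v , q , leaf , tree′ = tree-delete-leaf T tree
    in inj₂ (labelling₀₊₁ T leaf
         ([ (λ φ → contradiction (P-size {T = delete T v} φ) λ ()) , id ]′ (tree₀ (suc k) (delete T v) tree′)))

  -- A path is P₄ or is labelled explicitly. Any other tree loses three leaves, and the recursion
  -- continues with `tree₁` for the same `k`.
  tree₀ : ∀ k (T : Graph (4 + k * 4)) → IsTree T → T ≅ P 4 ⊎ Labelling₀ (suc k) T
  tree₀ k T tree = [ path k T , inj₂ ∘ branched ]′ (path-or-threeLeaves T tree)
    where
    path : ∀ k (T : Graph (4 + k * 4)) → T ≅ P (4 + k * 4) → T ≅ P 4 ⊎ Labelling₀ (suc k) T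
    path zero    T φ = inj₁ φ
    path (suc k) T φ = inj₂ (P-labelling₀ k T φ)
    branched : ThreeLeaves T → Labelling₀ (suc k) T
    branched leaves =
      let H , H-tree , _ , _ , _ , attached = delete-threeLeaves T tree leaves
      in [ labelling₀-of-P₅₊₃ k attached , labelling₁₊₃ attached ]′ (tree₁ k H H-tree)

labelling₂-of-delete : ∀ k (T : Graph (2 + k * 4)) → (∀ {H : Graph (1 + k * 4)} → ¬ (H ≅ P 5)) →
  IsTree T → Labelling₂ k T
labelling₂-of-delete k T ≇P₅ tree =
  let v , q , leaf , tree′ = tree-delete-leaf T tree
  in labelling₁₊₁ T leaf ([ (λ φ → contradiction φ (≇P₅ {delete T v})) , id ]′ (tree₁ k (delete T v) tree′))

tree₂ : ∀ k (T : Graph (2 + k * 4)) → IsTree T → Labelling₂ k T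
tree₂ zero T tree = labelling₂-of-delete zero T (λ {H} φ → contradiction (P-size {T = H} φ) λ ()) tree
-- On six vertices deleting one leaf could leave P₅. Hence P₆ is labelled directly and a branched
-- tree is reduced to P₃.
tree₂ (suc zero) T tree = [ P₆-labelling T , branched ]′ (path-or-threeLeaves T tree)
  where
  branched : ThreeLeaves T → Labelling₂ 1 T
  branched leaves =
    let H , H-tree , _ , _ , _ , attached = delete-threeLeaves T tree leaves
    in P₃₊₃-labelling attached (tree₃≅P₃ H H-tree)
tree₂ (suc (suc k)) T tree = labelling₂-of-delete (suc (suc k)) T (λ {H} φ → contradiction (P-size {T = H} φ) λ ()) tree

tree₃-cordial : ∀ k (T : Graph (3 + k * 4)) → IsTree T → ℤ₂²-Cordial T
tree₃-cordial k T tree with v , q , leaf , tree′ ← tree-delete-leaf T tree =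
  labelling₂₊₁⇒cordial T leaf (tree₂ k (delete T v) tree′)

-- Residues modulo 4 and conclusion

data Mod4 : ℕ → Set where
  4k+0 : ∀ k → Mod4 (k * 4)
  4k+1 : ∀ k → Mod4 (1 + k * 4)
  4k+2 : ∀ k → Mod4 (2 + k * 4)
  4k+3 : ∀ k → Mod4 (3 + k * 4)

mod4 : ∀ n → Mod4 n
mod4 zero = 4k+0 0
mod4 (suc n) with mod4 n
... | 4k+0 k = 4k+1 k
... | 4k+1 k = 4k+2 k
... | 4k+2 k = 4k+3 k
... | 4k+3 k = 4k+0 (suc k)

tree-cordial : (T : Graph (suc n)) → IsTree T → ¬ (T ≅ P 4) → ¬ (T ≅ P 5) → ℤ₂²-Cordial T
tree-cordial {n} T tree T≇P₄ T≇P₅ with mod4 n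
-- `n` is one less than the number of vertices, so each residue is shifted by one: this is the case
-- of `4k + 1` vertices.
... | 4k+0 k = [ (λ φ → contradiction φ T≇P₅) , labelling₁⇒cordial ]′ (tree₁ k T tree)
... | 4k+1 k = labelling₂⇒cordial (tree₂ k T tree)
... | 4k+2 k = tree₃-cordial k T tree
... | 4k+3 k = [ (λ φ → contradiction φ T≇P₄) , labelling₀⇒cordial ]′ (tree₀ k T tree)

theorem6p1 : ∀ (n : ℕ) (T : Graph n) → IsTree T →
    ℤ₂²-Cordial T ⇔ (¬ (T ≅ P 4) × ¬ (T ≅ P 5))
theorem6p1 zero T tree with () ← IsTree.nonEmpty tree
theorem6p1 (suc n) T tree = mk⇔
  (λ cordial → (λ φ → ≅P₄⇒¬cordial T φ cordial) , (λ φ → ≅P₅⇒¬cordial T φ cordial))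
  (λ (T≇P₄ , T≇P₅) → tree-cordial T tree T≇P₄ T≇P₅)
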